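{- For every positive integer $r$ there is a positive integer $n_0$ such that for all $n\ge n_0$, the graph $H_n$ of $V$'s and $Y$'s in the complete binary tree $T_n$ (defined in the context) has path-chromatic number larger than $r$, i.e. $\operatorname{pchr}(H_n)>r$.
   Context: The complete binary tree $T_n$ has as vertices all binary strings of length at most $n$ (including the empty string, the root); as a graph, $x$ is adjacent to $x0$ and $x1$. A $V$ in $T_n$ is a path in $T_n$ between two distinct vertices $y,z$ such that the vertex of the path closest to the root lies strictly between $y$ and $z$ on the path; this vertex $x$ is the low point of the $V$ and $y,z$ are its endpoints. A $Y$ in $T_n$ is a subtree of $T_n$ with exactly three leaves such that the vertex of the subtree closest to the root is one of its three leaves; that leaf is the lowest leaf of the $Y$ and the other two are its upper leaves. The graph $H_n$ has as vertex set all $V$'s and all $Y$'s in $T_n$, with adjacency: two $V$'s are adjacent when an endpoint of one is the low point of the other; two $Y$'s are adjacent when one of the upper leaves of one of them is the lowest leaf of the other; a $Y$ and a $V$ are adjacent when one of the upper leaves of the $Y$ is the low point of the $V$. A path-decomposition of a graph $G$ is a path $P$ together with subsets (bags) $B_t\subseteq V(G)$, $t\in V(P)$, such that every vertex of $G$ lies in some bag, both ends of every edge lie together in some bag, and for each vertex $v$ of $G$ the set of $t$ with $v\in B_t$ induces a connected subpath of $P$. The chromatic number of a path-decomposition is the maximum over $t$ of the chromatic number of the subgraph of $G$ induced by $B_t$; the path-chromatic number $\operatorname{pchr}(G)$ is the minimum chromatic number of a path-decomposition of $G$. -}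

module Defs where

open import Data.Bool using (Bool; true; false)
open import Data.List using (List; []; _∷_; _++_; length)
open import Data.Nat using (ℕ; _≤_)
open import Data.Fin using (Fin; toℕ)
open import Data.Product using (Σ; ∃; _×_)
open import Data.Sum using (_⊎_; inj₁; inj₂)
open import Data.Empty using (⊥)
open import Relation.Binary.PropositionalEquality using (_≡_; _≢_)
open import Relation.Nullary using (¬_)

-- Vertices of T_n are binary strings (List Bool) of length ≤ n;
-- x is adjacent to x ++ [0] and x ++ [1]; the root is [].
-- false = 0, true = 1.  Ancestors of a string are its prefixes.

-- A V in T_n: the (unique) tree path between two distinct vertices y, z
-- whose lowest vertex x lies strictly between them.  Then x is the
-- longest common prefix of y and z, and neither endpoint is a prefix
-- of the other; naming the endpoints so that y continues with 0 after x
-- and z continues with 1, a V is given uniquely by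
--   low point x, endpoints y = x ++ 0 ∷ u and z = x ++ 1 ∷ v.
record Vee (n : ℕ) : Set where
  constructor mkV
  field
    low : List Bool
    u   : List Bool
    v   : List Bool
    bound₀ : length (low ++ false ∷ u) ≤ n
    bound₁ : length (low ++ true ∷ v) ≤ n

  end₀ : List Bool
  end₀ = low ++ false ∷ u

  end₁ : List Bool
  end₁ = low ++ true ∷ v

-- A Y in T_n: a subtree with exactly three leaves, the root-closest
-- vertex being a leaf a (the lowest leaf).  Such a subtree is the union
-- of the paths from a to the two upper leaves b, c, which branch at a
-- vertex p = lca(b,c) strictly above a (else a would not be a leaf).
-- Writing p = a ++ s ∷ stem (nonempty extension), b = p ++ 0 ∷ u and
-- c = p ++ 1 ∷ v, a Y is given uniquely by (a, s, stem, u, v).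
record Why (n : ℕ) : Set where
  constructor mkY
  field
    lowest : List Bool
    s      : Bool
    stem   : List Bool
    u      : List Bool
    v      : List Bool

  branch : List Bool
  branch = lowest ++ s ∷ stem

  field
    bound₀ : length (branch ++ false ∷ u) ≤ n
    bound₁ : length (branch ++ true ∷ v) ≤ n

  up₀ : List Bool
  up₀ = branch ++ false ∷ u

  up₁ : List Bool
  up₁ = branch ++ true ∷ v

HVertex : ℕ → Set
HVertex n = Vee n ⊎ Why n

HArc : {n : ℕ} → HVertex n → HVertex n → Set
HArc (inj₁ A) (inj₁ B) = (Vee.end₀ A ≡ Vee.low B) ⊎ (Vee.end₁ A ≡ Vee.low B)
HArc (inj₂ Y) (inj₂ Z) = (Why.up₀ Y ≡ Why.lowest Z) ⊎ (Why.up₁ Y ≡ Why.lowest Z)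
HArc (inj₂ Y) (inj₁ A) = (Why.up₀ Y ≡ Vee.low A) ⊎ (Why.up₁ Y ≡ Vee.low A)
HArc (inj₁ _) (inj₂ _) = ⊥

HAdj : {n : ℕ} → HVertex n → HVertex n → Set
HAdj a b = HArc a b ⊎ HArc b a

-- Path-decomposition: the path P has vertices 0,1,…,len-1 (Fin len),
-- consecutive indices adjacent; bag t ⊆ V.
record PathDecomposition {V : Set} (E : V → V → Set) : Set₁ where
  field
    len   : ℕ
    bag   : Fin len → V → Set
    cover : ∀ x → ∃ λ t → bag t x
    edge  : ∀ x y → E x y → ∃ λ t → bag t x × bag t y
    interval : ∀ x (i t j : Fin len) → toℕ i ≤ toℕ t → toℕ t ≤ toℕ j →
               bag i x → bag j x → bag t x

Colourable : {V : Set} (E : V → V → Set) (S : V → Set) (r : ℕ) → Set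
Colourable {V} E S r =
  Σ (V → Fin r) λ c → ∀ x y → S x → S y → E x y → c x ≢ c y

PchrGreaterThan : {V : Set} (E : V → V → Set) (r : ℕ) → Set₁
PchrGreaterThan E r =
  (D : PathDecomposition E) →
  ∃ λ t → ¬ Colourable E (PathDecomposition.bag D t) r

{-# OPTIONS --safe #-}
module Submission where

-- A path-decomposition gives every V and Y an interval of the path, and
-- adjacent vertices of H_n have intersecting intervals.  For a tree vertex x let
-- lo x be the largest left end and hi x the smallest right end among the V's
-- with low point x (after shrinking their intervals to what the edges to Y's
-- force).  Every t in [lo x , hi x] lies in all these V's, while every Y with
-- upper leaf x has a point ≤ hi x and a point ≥ lo x.
--
-- Walk up the tree, alternately avoiding the side with the largest lo and the
-- side with the smallest hi, and remember these extremal vertices.  If a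
-- remembered lo is below a remembered hi, then that lo is a point t lying in
-- [lo x , hi x] for every later x of the walk.  Otherwise some t separates the
-- remembered hi's from the remembered lo's; for x on the walk with t outside
-- [lo x , hi x], a Y whose upper leaves are x and a remembered vertex on the
-- other side of t contains t.  Keeping only the x with t inside [lo x , hi x], or
-- only those with t outside, leaves a long chain of tree vertices such that the
-- bag at t contains a V from each member to each later one, or a Y from each
-- member to each later one.  These form a shift graph: in a proper r-colouring
-- the sets of colours leaving the members are pairwise distinct, so
-- the chain has at most 2 ^ r members.

open import Defs
open import Level using (Level)
open import Data.Bool using (Bool; true; false; not)
import Data.Bool.Properties as Bool
open import Data.Empty using (⊥-elim)
open import Data.Fin using (Fin; zero; suc; toℕ; funToFin; finToFun)
import Data.Fin as Fin
import Data.Fin.Properties as Fin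
open import Data.List using (List; []; _∷_; _++_; length; map; concatMap; filter; lookup)
open import Data.List.Properties using (length-++; ++-assoc; ++-identityʳ; ≡-dec)
import Data.List.Extrema as Extrema
open import Data.List.Membership.Propositional using (_∈_; lose)
open import Data.List.Membership.Propositional.Properties using (∈-map⁺; ∈-concatMap⁺)
open import Data.List.Relation.Unary.All as All using (All; []; _∷_)
import Data.List.Relation.Unary.All.Properties as All
open import Data.List.Relation.Unary.AllPairs as AllPairs using (AllPairs; []; _∷_)
import Data.List.Relation.Unary.AllPairs.Properties as AllPairs
open import Data.List.Relation.Unary.Any using (here; there)
open import Data.Nat using (ℕ; zero; suc; _+_; _*_; _^_; _≤_; _<_; _<?_; _≤?_; z≤n; s≤s; s<s)
import Data.Nat.Properties as ℕ
open import Data.Product using (Σ; ∃; ∃₂; _×_; _,_; proj₁; proj₂)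
open import Data.Sum using (_⊎_; inj₁; inj₂)
open import Function using (_∘_; id)
open import Relation.Binary.Bundles using (TotalOrder)
import Relation.Binary.Construct.Flip.EqAndOrd as Flip
open import Relation.Binary.PropositionalEquality using (_≡_; _≢_; refl; sym; trans; cong; subst)
open import Relation.Nullary using (¬_; Dec; yes; no)
open import Relation.Nullary.Decidable using (¬?; _⊎-dec_; _×-dec_)
open import Relation.Unary using (Decidable)

private
  variable
    a p ℓ : Level
    A B : Set a

-- Filtering and splitting lists

length-filter-∁ : {P : A → Set p} (P? : Decidable P) (xs : List A) →
  length (filter P? xs) + length (filter (¬? ∘ P?) xs) ≡ length xs
length-filter-∁ P? []       = refl
length-filter-∁ P? (x ∷ xs) with P? x
... | yes _ = cong suc (length-filter-∁ P? xs)
... | no  _ = trans (ℕ.+-suc _ _) (cong suc (length-filter-∁ P? xs))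

allPairs-with-all : {P : A → Set p} {R : A → A → Set ℓ} {xs : List A} →
  All P xs → AllPairs R xs → AllPairs (λ x y → P x × P y × R x y) xs
allPairs-with-all []         []         = []
allPairs-with-all (px ∷ pxs) (rx ∷ rxs) =
  All.zipWith (λ (py , r) → px , py , r) (pxs , rx) ∷ allPairs-with-all pxs rxs

allPairs-++⁻ : {R : A → A → Set ℓ} (xs : List A) {ys : List A} → AllPairs R (xs ++ ys) →
  AllPairs R xs × AllPairs R ys × All (λ x → All (R x) ys) xs
allPairs-++⁻ []       rs       = [] , rs , []
allPairs-++⁻ (x ∷ xs) (r ∷ rs) =
  let rxs , rys , rxys = allPairs-++⁻ xs rs
  in All.++⁻ˡ xs r ∷ rxs , rys , All.++⁻ʳ xs r ∷ rxys

split-at : (k m : ℕ) (xs : List A) → length xs ≡ k + suc m →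
  ∃ λ ys → ∃₂ λ y zs → xs ≡ ys ++ y ∷ zs × length ys ≡ k × length zs ≡ m
split-at zero    m (x ∷ xs) eq = [] , x , xs , refl , refl , ℕ.suc-injective eq
split-at (suc k) m (x ∷ xs) eq =
  let ys , y , zs , eq₁ , eq₂ , eq₃ = split-at k m xs (ℕ.suc-injective eq)
  in x ∷ ys , y , zs , cong (x ∷_) eq₁ , cong suc eq₂ , eq₃

-- Colouring shift graphs

module _ {E : A → A → Set ℓ} {r : ℕ} (c : ∀ {x y} → E x y → Fin r)
         (proper : ∀ {x y z} (e : E x y) (e′ : E y z) → c e ≢ c e′) where

  open import Data.List.Membership.DecPropositional (Fin._≟_ {r}) using (_∈?_)

  outColours : ∀ {xs} → AllPairs E xs → Fin (length xs) → List (Fin r)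
  outColours (es ∷ ess) zero    = All.reduce c es
  outColours (es ∷ ess) (suc i) = outColours ess i

  ∈-reduce⁻ : ∀ {x xs k} (es : All (E x) xs) → k ∈ All.reduce c es →
    ∃₂ λ z (e : E x z) → k ≡ c e
  ∈-reduce⁻ (e ∷ es) (here eq)  = _ , e , eq
  ∈-reduce⁻ (e ∷ es) (there k∈) = ∈-reduce⁻ es k∈

  ∈-reduce⁺ : ∀ {x xs} (es : All (E x) xs) (j : Fin (length xs)) →
    ∃ λ (e : E x (lookup xs j)) → c e ∈ All.reduce c es
  ∈-reduce⁺ (e ∷ es) zero    = e , here refl
  ∈-reduce⁺ (e ∷ es) (suc j) = let e′ , e′∈ = ∈-reduce⁺ es j in e′ , there e′∈

  ∈-outColours⁻ : ∀ {xs k} (ess : AllPairs E xs) i → k ∈ outColours ess i →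
    ∃₂ λ z (e : E (lookup xs i) z) → k ≡ c e
  ∈-outColours⁻ (es ∷ ess) zero    k∈ = ∈-reduce⁻ es k∈
  ∈-outColours⁻ (es ∷ ess) (suc i) k∈ = ∈-outColours⁻ ess i k∈

  -- The colour of the edge from member `i` to member `j` works: an edge of that colour leaving `j`
  -- would follow it, against `proper`.
  outColours-separated : ∀ {xs} (ess : AllPairs E xs) i j → toℕ i < toℕ j →
    ∃ λ k → k ∈ outColours ess i × ¬ k ∈ outColours ess j
  outColours-separated (es ∷ ess) zero (suc j) _ =
    let e , e∈ = ∈-reduce⁺ es j in
    c e , e∈ , λ k∈ → let _ , e′ , eq = ∈-outColours⁻ ess j k∈ in proper e e′ eq
  outColours-separated (es ∷ ess) (suc i) (suc j) (s<s i<j) =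
    outColours-separated ess i j i<j

  indicator : List (Fin r) → Fin r → Fin 2
  indicator ks k with k ∈? ks
  ... | yes _ = suc zero
  ... | no  _ = zero

  indicator-≢ : ∀ {k} ks ks′ → k ∈ ks → ¬ k ∈ ks′ → indicator ks k ≢ indicator ks′ k
  indicator-≢ {k} ks ks′ k∈ k∉ with k ∈? ks | k ∈? ks′
  ... | no k∉ks | _       = λ _ → k∉ks k∈
  ... | yes _   | yes k∈′ = λ _ → k∉ k∈′
  ... | yes _   | no _    = λ ()

  shift-length : ∀ {xs} → AllPairs E xs → length xs ≤ 2 ^ r
  shift-length {xs} ess = ℕ.≮⇒≥ λ 2^r<len →
    -- Indicator functions encode the colour sets as numbers below `2 ^ r`, so two members of an
    -- overlong chain share their set.
    let code i = funToFin (indicator (outColours ess i))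
        i , j , i<j , eq = Fin.pigeonhole 2^r<len code
        k , k∈ , k∉ = outColours-separated ess i j i<j
    in indicator-≢ (outColours ess i) (outColours ess j) k∈ k∉
         (trans (sym (Fin.finToFun-funToFin (indicator (outColours ess i)) k))
           (trans (cong (λ n → finToFun n k) eq)
             (Fin.finToFun-funToFin (indicator (outColours ess j)) k)))

-- Finite enumerations

record Enumeration (A : Set a) : Set a where
  field
    list     : List A
    complete : ∀ x → x ∈ list

open Enumeration

enumerate-bool : Enumeration Bool
enumerate-bool = record
  { list     = false ∷ true ∷ []
  ; complete = λ where false → here refl
                       true  → there (here refl) }

-- V's and Y's carry their length bounds as proofs; irrelevance of `≤` leaves at most one to list.
enumerate-≤ : ∀ m n → Enumeration (m ≤ n)
enumerate-≤ m n with m ≤? n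
... | yes h = record { list = h ∷ [] ; complete = λ h′ → here (ℕ.≤-irrelevant h′ h) }
... | no ¬h = record { list = [] ; complete = λ h → ⊥-elim (¬h h) }

enumerate-Σ : {B : A → Set ℓ} → Enumeration A → (∀ x → Enumeration (B x)) → Enumeration (Σ A B)
enumerate-Σ EA EB = record
  { list     = concatMap fibre (list EA)
  ; complete = λ (x , y) →
      ∈-concatMap⁺ fibre (lose (complete EA x) (∈-map⁺ (x ,_) (complete (EB x) y))) }
  where
  fibre = λ x → map (x ,_) (list (EB x))

enumerate-image : (f : A → B) (g : B → A) → (∀ y → f (g y) ≡ y) → Enumeration A → Enumeration B
enumerate-image f g f∘g E = record
  { list     = map f (list E)
  ; complete = λ y → subst (_∈ map f (list E)) (f∘g y) (∈-map⁺ f (complete E (g y))) }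

BoundedString : ℕ → Set
BoundedString n = ∃ λ (w : List Bool) → length w ≤ n

enumerate-strings : ∀ n → Enumeration (BoundedString n)
enumerate-strings zero    = record { list = ([] , z≤n) ∷ [] ; complete = λ where ([] , z≤n) → here refl }
enumerate-strings (suc n) = record
  { list     = ([] , z≤n) ∷ map cons (list E)
  ; complete = λ where
      ([] , z≤n)        → here refl
      (b ∷ w , s≤s h) → there (∈-map⁺ cons (complete E (b , w , h))) }
  where
  E = enumerate-Σ enumerate-bool (λ _ → enumerate-strings n)
  cons : Bool × BoundedString n → BoundedString (suc n)
  cons (b , w , h) = b ∷ w , s≤s h

suffix-length : ∀ {n} (w : List Bool) b (u : List Bool) → length (w ++ b ∷ u) ≤ n → length u ≤ n
suffix-length w b u h = ℕ.≤-trans (ℕ.n≤1+n _)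
  (ℕ.≤-trans (ℕ.m≤n+m _ (length w)) (subst (_≤ _) (length-++ w) h))

prefix-length : ∀ {n} (w u : List Bool) → length (w ++ u) ≤ n → length w ≤ n
prefix-length w u h = ℕ.≤-trans (ℕ.m≤m+n _ (length u)) (subst (_≤ _) (length-++ w) h)

VeeAt : ℕ → List Bool → Set
VeeAt n x = ∃ λ (V : Vee n) → Vee.low V ≡ x

enumerate-veesAt : ∀ n x → Enumeration (VeeAt n x)
enumerate-veesAt n x = enumerate-image
  (λ ((u , _) , (v , _) , h₀ , h₁) → mkV x u v h₀ h₁ , refl)
  (λ where (mkV _ u v h₀ h₁ , refl) →
             (u , suffix-length x _ u h₀) , (v , suffix-length x _ v h₁) , h₀ , h₁)
  (λ where (mkV _ _ _ _ _ , refl) → refl)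
  (enumerate-Σ (enumerate-strings n) λ _ →
   enumerate-Σ (enumerate-strings n) λ _ →
   enumerate-Σ (enumerate-≤ _ n) λ _ → enumerate-≤ _ n)

enumerate-whys : ∀ n → Enumeration (Why n)
enumerate-whys n = enumerate-image
  (λ ((x , _) , s , (stem , _) , (u , _) , (v , _) , h₀ , h₁) → mkY x s stem u v h₀ h₁)
  (λ where
    (mkY x s stem u v h₀ h₁) →
      let w = x ++ s ∷ stem
          h = prefix-length w _ h₀
      in (x , prefix-length x _ h) , s , (stem , suffix-length x s stem h) ,
         (u , suffix-length w _ u h₀) , (v , suffix-length w _ v h₁) , h₀ , h₁)
  (λ where (mkY _ _ _ _ _ _ _) → refl)
  (enumerate-Σ (enumerate-strings n) λ _ →
   enumerate-Σ enumerate-bool λ _ →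
   enumerate-Σ (enumerate-strings n) λ _ →
   enumerate-Σ (enumerate-strings n) λ _ →
   enumerate-Σ (enumerate-strings n) λ _ →
   enumerate-Σ (enumerate-≤ _ n) λ _ → enumerate-≤ _ n)

-- Extremal hanging vertices

module _ {c ℓ₁ ℓ₂} (O : TotalOrder c ℓ₁ ℓ₂) where
  open TotalOrder O using (total) renaming (Carrier to C; _≤_ to _≼_; trans to ≼-trans)
  open Extrema O

  -- The walk enters `b` and remembers a vertex under `not b`, which stays extremal whatever is met
  -- up to depth `k` above `b`.
  DominatedChild : (List Bool → C) → ℕ → Bool → Set ℓ₂
  DominatedChild f k b = ∃ λ u → length u ≤ k × (∀ w → length w ≤ k → f (b ∷ w) ≼ f (not b ∷ u))

  dominated-child : (f : List Bool → C) (k : ℕ) → ∃ (DominatedChild f k)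
  dominated-child f k = compare (total (f (false ∷ best false)) (f (true ∷ best true)))
    where
    argbest : Bool → BoundedString k
    argbest b = argmax (λ (w , _) → f (b ∷ w)) ([] , z≤n) (list (enumerate-strings k))

    best : Bool → List Bool
    best b = proj₁ (argbest b)

    best-max : ∀ b w → length w ≤ k → f (b ∷ w) ≼ f (b ∷ best b)
    best-max b w h =
      All.lookup (f[xs]≤f[argmax] {f = λ (w , _) → f (b ∷ w)} _ (list (enumerate-strings k)))
        (complete (enumerate-strings k) (w , h))

    compare : f (false ∷ best false) ≼ f (true ∷ best true) ⊎
              f (true ∷ best true) ≼ f (false ∷ best false) → _
    compare (inj₁ le) = false , best true , proj₂ (argbest true) , λ w h → ≼-trans (best-max false w h) le
    compare (inj₂ le) = true , best false , proj₂ (argbest false) , λ w h → ≼-trans (best-max true w h) le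

-- The walk and its stages

Within : List Bool → ℕ → List Bool → Set
Within x d y = ∃ λ w → length w ≤ d × y ≡ x ++ w

within-extend : ∀ {x y d} (w : List Bool) → Within (x ++ w) d y → Within x (length w + d) y
within-extend {x} w (w′ , h , refl) =
  w ++ w′ , ℕ.≤-trans (ℕ.≤-reflexive (length-++ w)) (ℕ.+-monoʳ-≤ (length w) h) , ++-assoc x w w′

-- Three steps of the walk, 0 b₁ b₂ from node: upper maximises lo and lower
-- minimises hi.  Both branch off strictly above node, as a Y requires.
record Stage : Set where
  field
    node  : List Bool
    b₁ b₂ : Bool
    u v   : List Bool

  upper : List Bool
  upper = node ++ false ∷ not b₁ ∷ u

  lower : List Bool
  lower = node ++ false ∷ b₁ ∷ not b₂ ∷ v

open Stage

module Spine {l : ℕ} (lo hi : List Bool → Fin l) where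

  -- Along the walk the remembered `lo` values weakly fall and the remembered `hi` values weakly
  -- rise, so comparing them at one stage informs about all others.
  record Follows (s s′ : Stage) : Set where
    field
      tail     : List Bool
      node-eq  : node s′ ≡ node s ++ false ∷ b₁ s ∷ b₂ s ∷ tail
      lo-node  : lo (node s′) Fin.≤ lo (upper s)
      hi-node  : hi (lower s) Fin.≤ hi (node s′)
      lo-upper : lo (upper s′) Fin.≤ lo (upper s)
      hi-lower : hi (lower s) Fin.≤ hi (lower s′)

  StageWithin : List Bool → ℕ → Stage → Set
  StageWithin x d s = Within x d (node s) × Within x d (upper s) × Within x d (lower s)

  HasSpine : ℕ → List Bool → Set
  HasSpine k x = ∃ λ ss → length ss ≡ k × All (StageWithin x (k * 3)) ss × AllPairs Follows ss

  -- The first depth is one larger since the choice of `c₁` must also cover the turn `c₂`. Flipping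
  -- the order makes the second extremum a minimum.
  extend-spine : ∀ {k} x c₁ c₂ →
    DominatedChild (Fin.≤-totalOrder l) (λ w → lo (x ++ false ∷ w)) (suc (k * 3)) c₁ →
    DominatedChild (Flip.totalOrder (Fin.≤-totalOrder l)) (λ w → hi (x ++ false ∷ c₁ ∷ w)) (k * 3) c₂ →
    HasSpine k (x ++ false ∷ c₁ ∷ c₂ ∷ []) → HasSpine (suc k) x
  extend-spine {k} x c₁ c₂ (y , y≤ , lo≤) (z , z≤ , ≤hi) (ss , len , within , follows) =
    s ∷ ss , cong suc len ,
    (([] , z≤n , sym (++-identityʳ x)) , (_ , s≤s (s≤s y≤) , refl) , (_ , s≤s (s≤s (s≤s z≤)) , refl)) ∷
      All.map (λ (n , up , low) →
        within-extend turn n , within-extend turn up , within-extend turn low) within ,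
    All.map follow within ∷ follows
    where
    turn = false ∷ c₁ ∷ c₂ ∷ []

    s : Stage
    s = record { node = x ; b₁ = c₁ ; b₂ = c₂ ; u = y ; v = z }

    lo-bound : ∀ {q} → Within (x ++ turn) (k * 3) q → lo q Fin.≤ lo (upper s)
    lo-bound (w , h , refl) = subst (λ q → lo q Fin.≤ lo (upper s))
      (sym (++-assoc x turn w)) (lo≤ (c₂ ∷ w) (s≤s h))

    hi-bound : ∀ {q} → Within (x ++ turn) (k * 3) q → hi (lower s) Fin.≤ hi q
    hi-bound (w , h , refl) = subst (λ q → hi (lower s) Fin.≤ hi q)
      (sym (++-assoc x turn w)) (≤hi w h)

    follow : ∀ {s′} → StageWithin (x ++ turn) (k * 3) s′ → Follows s s′
    follow (n@(w , _ , eq) , up , low) = record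
      { tail = w ; node-eq = trans eq (++-assoc x turn w)
      ; lo-node = lo-bound n ; hi-node = hi-bound n
      ; lo-upper = lo-bound up ; hi-lower = hi-bound low }

  spine : ∀ k x → HasSpine k x
  spine zero    x = [] , refl , [] , []
  spine (suc k) x = extend-spine x _ _ (proj₂ first) (proj₂ second) (spine k _)
    where
    first  = dominated-child (Fin.≤-totalOrder l) (λ w → lo (x ++ false ∷ w)) (suc (k * 3))
    second = dominated-child (Flip.totalOrder (Fin.≤-totalOrder l))
               (λ w → hi (x ++ false ∷ proj₁ first ∷ w)) (k * 3)

-- Y's with two prescribed upper leaves

UpperLeaf : ∀ {n} → Why n → List Bool → Set
UpperLeaf Y x = Why.up₀ Y ≡ x ⊎ Why.up₁ Y ≡ x

why-between : ∀ {n} x s stem b u v →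
  length (x ++ s ∷ stem ++ b ∷ u) ≤ n → length (x ++ s ∷ stem ++ not b ∷ v) ≤ n →
  ∃ λ (Y : Why n) → Why.lowest Y ≡ x ×
    UpperLeaf Y (x ++ s ∷ stem ++ b ∷ u) × UpperLeaf Y (x ++ s ∷ stem ++ not b ∷ v)
why-between {n} x s stem b u v h h′ = go b h h′
  where
  assoc : ∀ w → (x ++ s ∷ stem) ++ w ≡ x ++ s ∷ stem ++ w
  assoc = ++-assoc x (s ∷ stem)
  fit : ∀ w → length (x ++ s ∷ stem ++ w) ≤ n → length ((x ++ s ∷ stem) ++ w) ≤ n
  fit w = subst (λ z → length z ≤ n) (sym (assoc w))
  go : ∀ b → length (x ++ s ∷ stem ++ b ∷ u) ≤ n → length (x ++ s ∷ stem ++ not b ∷ v) ≤ n →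
    ∃ λ (Y : Why n) → Why.lowest Y ≡ x ×
      UpperLeaf Y (x ++ s ∷ stem ++ b ∷ u) × UpperLeaf Y (x ++ s ∷ stem ++ not b ∷ v)
  go false h h′ = mkY x s stem u v (fit _ h) (fit _ h′) , refl , inj₁ (assoc _) , inj₂ (assoc _)
  go true  h h′ = mkY x s stem v u (fit _ h′) (fit _ h) , refl , inj₂ (assoc _) , inj₁ (assoc _)

-- The points lo x and hi x

module _ {n : ℕ} (D : PathDecomposition (HAdj {n})) where
  open PathDecomposition D
  open Extrema (Fin.≤-totalOrder len)

  arc? : (Y : Why n) (V : Vee n) → Dec (HArc (inj₂ Y) (inj₁ V))
  arc? Y V = ≡-dec Bool._≟_ _ _ ⊎-dec ≡-dec Bool._≟_ _ _

  -- Non-adjacent pairs get a point of V, so that every value is usable for V.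
  meeting : (V : Vee n) (Y : Why n) →
    ∃ λ t → bag t (inj₁ V) × (HArc (inj₂ Y) (inj₁ V) → bag t (inj₂ Y))
  meeting V Y with arc? Y V
  ... | yes arc = let t , tV , tY = edge (inj₁ V) (inj₂ Y) (inj₂ arc) in t , tV , λ _ → tY
  ... | no ¬arc = let t , tV = cover (inj₁ V) in t , tV , λ arc → ⊥-elim (¬arc arc)

  point : Vee n → Why n → Fin len
  point V Y = proj₁ (meeting V Y)

  coverPoint : Vee n → Fin len
  coverPoint V = proj₁ (cover (inj₁ V))

  points : Vee n → List (Fin len)
  points V = map (point V) (list (enumerate-whys n))

  -- The shrunken interval: it contains a meeting point for each Y, so every Y adjacent to `V` has a
  -- point between these ends.
  leftEnd rightEnd : Vee n → Fin len
  leftEnd  V = min (coverPoint V) (points V)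
  rightEnd V = max (coverPoint V) (points V)

  points-bag : ∀ V → All (λ t → bag t (inj₁ V)) (points V)
  points-bag V = All.map⁺ (All.universal (λ Y → proj₁ (proj₂ (meeting V Y))) _)

  ∈-points : ∀ V Y → point V Y ∈ points V
  ∈-points V Y = ∈-map⁺ (point V) (complete (enumerate-whys n) Y)

  ends-bag : ∀ V t → leftEnd V Fin.≤ t → t Fin.≤ rightEnd V → bag t (inj₁ V)
  ends-bag V t l≤t t≤r = interval (inj₁ V) (leftEnd V) t (rightEnd V) l≤t t≤r
    (argmin-all id (proj₂ (cover (inj₁ V))) (points-bag V))
    (argmax-all id (proj₂ (cover (inj₁ V))) (points-bag V))

  record IsPivot (x : List Bool) (lo hi : Fin len) : Set where
    field
      vees  : ∀ V t → Vee.low V ≡ x → lo Fin.≤ t → t Fin.≤ hi → bag t (inj₁ V)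
      left  : ∀ Y → UpperLeaf Y x → ∃ λ t → t Fin.≤ hi × bag t (inj₂ Y)
      right : ∀ Y → UpperLeaf Y x → ∃ λ t → lo Fin.≤ t × bag t (inj₂ Y)

  -- `Vlo` has the largest left end and `Vhi` the smallest right end. A Y with upper leaf `x` is
  -- adjacent to both, and its meeting point with each gives `right` and `left`.
  pivot : ∀ x → length x < n → ∃₂ (IsPivot x)
  pivot x x<n = leftEnd Vlo , rightEnd Vhi , record
    { vees = λ V t eq lo≤t t≤hi → ends-bag V t
        (Fin.≤-trans (All.lookup (f[xs]≤f[argmax] {f = leftEnd ∘ proj₁} V₀ Vs) (complete E (V , eq))) lo≤t)
        (Fin.≤-trans t≤hi (All.lookup (f[argmin]≤f[xs] {f = rightEnd ∘ proj₁} V₀ Vs) (complete E (V , eq))))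
    ; left = λ Y leaf → point Vhi Y ,
        All.lookup (xs≤max _ (points Vhi)) (∈-points Vhi Y) ,
        proj₂ (proj₂ (meeting Vhi Y)) (leaf-arc Y Vhi (proj₂ Vhi′) leaf)
    ; right = λ Y leaf → point Vlo Y ,
        All.lookup (min≤xs _ (points Vlo)) (∈-points Vlo Y) ,
        proj₂ (proj₂ (meeting Vlo Y)) (leaf-arc Y Vlo (proj₂ Vlo′) leaf) }
    where
    E = enumerate-veesAt n x
    Vs = list E

    fits : ∀ b → length (x ++ b ∷ []) ≤ n
    fits b = ℕ.≤-trans (ℕ.≤-reflexive (trans (length-++ x) (ℕ.+-comm _ 1))) x<n

    V₀ Vlo′ Vhi′ : VeeAt n x
    -- Both children of `x` exist, so the extrema have a V to start from.
    V₀   = mkV x [] [] (fits false) (fits true) , refl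
    Vlo′ = argmax (leftEnd ∘ proj₁) V₀ Vs
    Vhi′ = argmin (rightEnd ∘ proj₁) V₀ Vs

    Vlo Vhi : Vee n
    Vlo = proj₁ Vlo′
    Vhi = proj₁ Vhi′

    leaf-arc : ∀ Y V → Vee.low V ≡ x → UpperLeaf Y x → HArc (inj₂ Y) (inj₁ V)
    leaf-arc Y V refl leaf = leaf

  -- lo and hi are junk when length x ≥ n, where no V has low point x.
  pivots : 0 < n → ∀ x → ∃₂ λ lo hi → length x < n → IsPivot x lo hi
  pivots 0<n x with length x <? n
  ... | yes x<n = let lo , hi , isPivot = pivot x x<n in lo , hi , λ _ → isPivot
  ... | no  x≮n = let lo , hi , _ = pivot [] 0<n in lo , hi , λ x<n → ⊥-elim (x≮n x<n)

  -- Bags met along the walk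

  module _ (lo hi : List Bool → Fin len) (isPivot : ∀ x → length x < n → IsPivot x (lo x) (hi x)) where
    open Spine lo hi
    open IsPivot

    StageBound : Stage → Set
    StageBound s = length (node s) < n × length (upper s) < n × length (lower s) < n

    stageBound : ∀ {d} → d < n → ∀ {s} → StageWithin [] d s → StageBound s
    stageBound d<n ((_ , h₁ , refl) , (_ , h₂ , eq₂) , (_ , h₃ , eq₃)) =
      ℕ.≤-<-trans h₁ d<n ,
      subst (λ w → length w < n) (sym eq₂) (ℕ.≤-<-trans h₂ d<n) ,
      subst (λ w → length w < n) (sym eq₃) (ℕ.≤-<-trans h₃ d<n)

    module _ (t : Fin len) where

      Covered : Stage → Set
      Covered s = lo (node s) Fin.≤ t × t Fin.≤ hi (node s)

      covered? : Decidable Covered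
      covered? s = (lo (node s) Fin.≤? t) ×-dec (t Fin.≤? hi (node s))

      Separated : Stage → Set
      Separated s = hi (lower s) Fin.≤ t × t Fin.≤ lo (upper s)

      VeeEdge WhyEdge : Stage → Stage → Set
      VeeEdge s s′ = ∃ λ V → Vee.low V ≡ node s × Vee.end₀ V ≡ node s′ × bag t (inj₁ V)
      WhyEdge s s′ = ∃ λ Y → Why.lowest Y ≡ node s × UpperLeaf Y (node s′) × bag t (inj₂ Y)

      -- Each stage leaves its node by 0, so `node s′` can be `end₀`; the child 1 of `node s` serves
      -- as the other endpoint.
      vee-edge : ∀ {s s′} → StageBound s → StageBound s′ → Covered s → Follows s s′ → VeeEdge s s′
      vee-edge {s} {s′} (s<n , _) (s′<n , _) (lo≤t , t≤hi) f =
        V , refl , sym node-eq , vees (isPivot (node s) s<n) V t refl lo≤t t≤hi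
        where
        open Follows f
        V : Vee n
        V = mkV (node s) (b₁ s ∷ b₂ s ∷ tail) []
          (subst (λ w → length w ≤ n) node-eq (ℕ.<⇒≤ s′<n))
          (ℕ.≤-trans (ℕ.≤-reflexive (trans (length-++ (node s)) (ℕ.+-comm _ 1))) s<n)

      why-bag : ∀ {x y} Y → length x < n → length y < n → UpperLeaf Y x → UpperLeaf Y y →
        hi x Fin.≤ t → t Fin.≤ lo y → bag t (inj₂ Y)
      why-bag Y x<n y<n leaf leaf′ hi≤t t≤lo =
        let i , i≤ , Yi = left (isPivot _ x<n) Y leaf
            j , ≤j , Yj = right (isPivot _ y<n) Y leaf′
        in interval (inj₂ Y) i t j (ℕ.≤-trans i≤ hi≤t) (ℕ.≤-trans t≤lo ≤j) Yi Yj

      -- If `node s′` has its `hi` at most `t`, `upper s` is the partner leaf with `lo` at least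
      -- `t`. Otherwise its `lo` is at least `t`, and `lower s` is the partner with `hi` at most
      -- `t`.
      why-edge : ∀ {s s′} → StageBound s → StageBound s′ → Separated s → ¬ Covered s′ →
        Follows s s′ → WhyEdge s s′
      why-edge {s} {s′} (_ , up<n , low<n) (s′<n , _) (low≤t , t≤up) ¬cov f with hi (node s′) Fin.≤? t
      ... | yes hi≤t =
        let Y , eq , leaf , leaf′ = why-between (node s) false [] (b₁ s) (b₂ s ∷ tail) (u s) fits (ℕ.<⇒≤ up<n)
            leaf″ = subst (UpperLeaf Y) (sym node-eq) leaf
        in Y , eq , leaf″ , why-bag Y s′<n up<n leaf″ leaf′ hi≤t t≤up
        where
        open Follows f
        fits = subst (λ w → length w ≤ n) node-eq (ℕ.<⇒≤ s′<n)
      ... | no hi≰t =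
        let Y , eq , leaf , leaf′ = why-between (node s) false (b₁ s ∷ []) (b₂ s) tail (v s) fits (ℕ.<⇒≤ low<n)
            leaf″ = subst (UpperLeaf Y) (sym node-eq) leaf
        in Y , eq , leaf″ , why-bag Y low<n s′<n leaf′ leaf″ low≤t t≤lo
        where
        open Follows f
        fits = subst (λ w → length w ≤ n) node-eq (ℕ.<⇒≤ s′<n)
        t≤lo : t Fin.≤ lo (node s′)
        t≤lo = ℕ.≰⇒≥ λ lo≤t → ¬cov (lo≤t , ℕ.≰⇒≥ hi≰t)

      module _ {r : ℕ} (colouring : Colourable HAdj (bag t) r) where

        vee-chain : ∀ {ss} → AllPairs VeeEdge ss → length ss ≤ 2 ^ r
        vee-chain = shift-length (λ (V , _) → proj₁ colouring (inj₁ V))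
          λ (V , _ , end , tV) (V′ , low , _ , tV′) →
            proj₂ colouring (inj₁ V) (inj₁ V′) tV tV′ (inj₁ (inj₁ (trans end (sym low))))

        why-chain : ∀ {ss} → AllPairs WhyEdge ss → length ss ≤ 2 ^ r
        why-chain = shift-length (λ (Y , _) → proj₁ colouring (inj₂ Y))
          λ (Y , _ , leaf , tY) (Y′ , low , _ , tY′) →
            proj₂ colouring (inj₂ Y) (inj₂ Y′) tY tY′ (inj₁ (subst (UpperLeaf Y) (sym low) leaf))

        covered-chain : ∀ {ss} → All StageBound ss → All Covered ss → AllPairs Follows ss →
          length ss ≤ 2 ^ r
        covered-chain bs cs fs = vee-chain
          (AllPairs.map (λ ((b , cov) , (b′ , _) , f) → vee-edge b b′ cov f)
            (allPairs-with-all (All.zip (bs , cs)) fs))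

        separated-chain : ∀ {ss} → All StageBound ss → All Separated ss → AllPairs Follows ss →
          length ss ≤ 2 ^ r + 2 ^ r
        separated-chain {ss} bs seps fs = subst (_≤ 2 ^ r + 2 ^ r) (length-filter-∁ covered? ss)
          (ℕ.+-mono-≤
            (covered-chain (All.filter⁺ covered? bs) (All.all-filter covered? ss)
              (AllPairs.filter⁺ covered? fs))
            (why-chain
              (AllPairs.map (λ ((b , sep , _) , (b′ , _ , ¬cov) , f) → why-edge b b′ sep ¬cov f)
                (allPairs-with-all
                  (All.zip (All.filter⁺ (¬? ∘ covered?) bs ,
                    All.zip (All.filter⁺ (¬? ∘ covered?) seps , All.all-filter (¬? ∘ covered?) ss)))
                  (AllPairs.filter⁺ (¬? ∘ covered?) fs)))))

    bad-bag-at : ∀ {r} xs e ys → 2 ^ r + 2 ^ r < length xs → 2 ^ r < length ys →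
      All StageBound (xs ++ e ∷ ys) → AllPairs Follows (xs ++ e ∷ ys) →
      ∃ λ t → ¬ Colourable HAdj (bag t) r
    bad-bag-at xs e ys xs-long ys-long bounds follows
      with allPairs-++⁻ xs follows | hi (lower e) Fin.≤? lo (upper e)
    -- Going back from `e`, `hi` of `lower` only falls and `lo` of `upper` only rises, so this `t`
    -- separates them at every earlier stage.
    ... | fxs , _ , fxys | yes low≤up = hi (lower e) , λ col → ℕ.<⇒≱ xs-long
      (separated-chain (hi (lower e)) col (All.++⁻ˡ xs bounds)
        (All.map (λ where (f ∷ _) → hi-lower f , ℕ.≤-trans low≤up (lo-upper f)) fxys) fxs)
      where open Follows
    -- Later nodes have `lo` at most `lo (upper e)` and `hi` at least `hi (lower e)`, so this `t`
    -- covers them all.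
    ... | _ , (fe ∷ fys) , _ | no low≰up = lo (upper e) , λ col → ℕ.<⇒≱ ys-long
      (covered-chain (lo (upper e)) col (All.tail (All.++⁻ʳ xs bounds))
        (All.map (λ f → lo-node f , ℕ.≤-trans (ℕ.≰⇒≥ low≰up) (hi-node f)) fe) fys)
      where open Follows

    bad-bag : ∀ {r} k m → 2 ^ r + 2 ^ r < k → 2 ^ r < m → (k + suc m) * 3 < n →
      ∃ λ t → ¬ Colourable HAdj (bag t) r
    bad-bag k m r<k r<m d<n =
      let ss , len-ss , within , follows = spine (k + suc m) []
          xs , e , ys , eq , len-xs , len-ys = split-at k m ss len-ss
      in bad-bag-at xs e ys (subst (_ <_) (sym len-xs) r<k) (subst (_ <_) (sym len-ys) r<m)
           (subst (All StageBound) eq (All.map (stageBound d<n) within))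
           (subst (AllPairs Follows) eq follows)

theorem3 : (r : ℕ) → 1 ≤ r →
    ∃ λ n₀ → 1 ≤ n₀ × ((n : ℕ) → n₀ ≤ n → PchrGreaterThan (HAdj {n}) r)
-- The walk has `k` stages, a middle one and `m` more, three steps each; the `suc` leaves room for a
-- V at every vertex used.
theorem3 r _ = suc ((k + suc m) * 3) , s≤s z≤n , λ n d<n D →
  let pv = pivots D (ℕ.≤-trans (s≤s z≤n) d<n)
  in bad-bag D (proj₁ ∘ pv) (proj₁ ∘ proj₂ ∘ pv) (λ x → proj₂ (proj₂ (pv x))) k m ℕ.≤-refl ℕ.≤-refl d<n
  where
  k = suc (2 ^ r + 2 ^ r)
  m = suc (2 ^ r)
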